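{- Let $M$ be a connected binary matroid. If $M$ has a pair of skew circuits, then $M$ is not circuit-difference.
   Context: All matroids are finite. A matroid $M$ is circuit-difference if the symmetric difference $C_1\triangle C_2$ is a circuit of $M$ whenever $C_1$ and $C_2$ are distinct circuits of $M$ with $C_1\cap C_2\neq\emptyset$. Subsets $X$ and $Y$ of $E(M)$ are skew if $r(X\cup Y)=r(X)+r(Y)$, where $r$ is the rank function of $M$. A pair of skew circuits consists of two distinct circuits that are skew. -}

module Defs where

open import Algebra.Bundles using (CommutativeRing)
open import Algebra.Properties.Semiring.Sum using (sum)
open import Data.Bool.Properties using (xor-∧-commutativeRing)
open import Data.Fin using (Fin)
open import Data.Fin.Subset
  using (Subset; inside; outside; ⊥; ⁅_⁆; _∈_; _∉_; _⊆_; _⊂_; _∩_; _∪_; _─_; ∣_∣; Nonempty)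
open import Data.Fin.Subset.Properties using (_⊆?_)
open import Data.List using (List; [_]; map; filter; _++_)
open import Data.List.Extrema.Nat using (max)
open import Data.Nat using (ℕ; zero; suc; _+_; _<_)
open import Data.Product using (_×_; ∃-syntax)
open import Data.Vec using ([]; _∷_)
open import Function.Bundles using (_⇔_)
open import Relation.Binary.PropositionalEquality using (_≡_; _≢_)
open import Relation.Nullary using (¬_)
open import Relation.Nullary.Decidable using (_×-dec_)
open import Relation.Unary using (Decidable)

infixl 5 _△_

_△_ : ∀ {n} → Subset n → Subset n → Subset n
X △ Y = (X ─ Y) ∪ (Y ─ X)

allSubsets : ∀ n → List (Subset n)
allSubsets zero    = [ [] ]
allSubsets (suc n) = map (outside ∷_) (allSubsets n) ++ map (inside ∷_) (allSubsets n)

-- The ground set of a finite matroid is taken to be Fin n, where n may be 0.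
-- Independence is a decidable predicate, as it is classically for any family
-- of subsets; this makes the rank function computable.
record Matroid (n : ℕ) : Set₁ where
  field
    Indep        : Subset n → Set
    indep?       : Decidable Indep
    ⊥-indep      : Indep ⊥
    hereditary   : ∀ {I J} → I ⊆ J → Indep J → Indep I
    augmentation : ∀ {I J} → Indep I → Indep J → ∣ I ∣ < ∣ J ∣ →
                   ∃[ e ] e ∈ J × e ∉ I × Indep (I ∪ ⁅ e ⁆)

  IsCircuit : Subset n → Set
  IsCircuit C = ¬ Indep C × (∀ {I} → I ⊂ C → Indep I)

  -- The maximum size of an independent subset of X. The default value 0 of
  -- max plays no role, since ⊥ is independent.
  rank : Subset n → ℕ
  rank X = max 0 (map ∣_∣ (filter (λ I → (I ⊆? X) ×-dec indep? I) (allSubsets n)))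

  Skew : Subset n → Subset n → Set
  Skew X Y = rank (X ∪ Y) ≡ rank X + rank Y

  HasSkewCircuits : Set
  HasSkewCircuits =
    ∃[ C₁ ] ∃[ C₂ ] IsCircuit C₁ × IsCircuit C₂ × C₁ ≢ C₂ × Skew C₁ C₂

  IsConnected : Set
  IsConnected = ∀ {e f} → e ≢ f → ∃[ C ] IsCircuit C × e ∈ C × f ∈ C

  IsCircuitDifference : Set
  IsCircuitDifference =
    ∀ {C₁ C₂} → IsCircuit C₁ → IsCircuit C₂ → C₁ ≢ C₂ →
    Nonempty (C₁ ∩ C₂) → IsCircuit (C₁ △ C₂)

-- The two-element field: addition is xor and multiplication is ∧ on Bool.
module GF₂ = CommutativeRing xor-∧-commutativeRing

-- An m × n matrix over GF(2): entry A i j is in row i and column j.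
Matrix : ℕ → ℕ → Set
Matrix m n = Fin m → Fin n → GF₂.Carrier

-- The columns are an indexed family, so equal columns with different indices
-- are dependent.
ColumnsIndependent : ∀ {m n} → Matrix m n → Subset n → Set
ColumnsIndependent {n = n} A X =
  (c : Fin n → GF₂.Carrier) → (∀ {j} → j ∉ X → c j ≡ GF₂.0#) →
  (∀ i → sum GF₂.semiring (λ j → c j GF₂.* A i j) ≡ GF₂.0#) →
  ∀ j → c j ≡ GF₂.0#

-- M is the vector matroid of a matrix over GF(2); an isomorphism of ground
-- sets is absorbed by permuting the columns.
IsBinary : ∀ {n} → Matroid n → Set
IsBinary {n} M =
  ∃[ m ] ∃[ A ] (∀ X → Matroid.Indep M X ⇔ ColumnsIndependent {m} {n} A X)

{-# OPTIONS --safe #-}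

-- Suppose M is circuit-difference with skew circuits C₁ and C₂. A basis I of
-- C₁ ∪ C₂ has at least |C₁| + |C₂| − 2 elements, whereas every circuit leaves I.
-- If C₁ and C₂ met, then C₁ ∪ C₂ would have at most one element outside I, and
-- not all of the circuits C₁, C₂ and C₁ △ C₂ could contain it. So C₁ and C₂ are
-- disjoint and I omits exactly one element of each. By connectedness some
-- circuit D meets both of them, and then D △ C₁, D △ C₂ and D △ C₁ △ C₂ are
-- circuits too. One of these four circuits avoids the two omitted elements, so
-- D is not contained in C₁ ∪ C₂. Hence D meets D △ C₁ △ C₂ outside C₁ ∪ C₂, and
-- the symmetric difference of these two circuits is C₁ ∪ C₂, which properly
-- contains the circuit C₁: a contradiction.

module Submission where

open import Defs
open import Data.Empty using (⊥-elim) renaming (⊥ to Absurd)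
open import Data.Fin using (_≟_)
open import Data.Fin.Subset
  using (Subset; inside; outside; ⁅_⁆; _∈_; _∉_; _⊆_; _∪_; _─_; _-_; ∣_∣; Nonempty)
open import Data.Fin.Subset.Properties
open import Data.List.Extrema.Nat using (argmax-sel; xs≤max)
import Data.List.Membership.Propositional as List
open import Data.List.Membership.Propositional.Properties
  using (∈-map⁺; ∈-map⁻; ∈-++⁺ˡ; ∈-++⁺ʳ; ∈-filter⁺; ∈-filter⁻)
import Data.List.Relation.Unary.All as All
open import Data.List.Relation.Unary.Any using (here)
open import Data.Nat using (ℕ; suc; _+_; _≤_; _<_; z≤n; s≤s)
open import Data.Nat.Properties
  using (≤-refl; ≤-reflexive; ≤-trans; <-≤-trans; <-irrefl; +-suc; +-monoʳ-≤;
         +-monoʳ-<; +-mono-≤; m≤n⇒m≤1+n; module ≤-Reasoning)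
open import Data.Product using (_×_; _,_; proj₁; ∃-syntax)
open import Data.Sum using (_⊎_; inj₁; inj₂)
open import Data.Vec using ([]; _∷_; here; there)
open import Function using (id; case_of_)
open import Relation.Binary.PropositionalEquality
  using (_≡_; _≢_; refl; sym; cong; subst; ≢-sym)
open import Relation.Nullary using (¬_; yes; no; contradiction)
open import Relation.Nullary.Decidable using (_×-dec_)

-- Finite subsets and their cardinalities.

∈-allSubsets : ∀ {n} (X : Subset n) → X List.∈ allSubsets n
∈-allSubsets []            = here refl
∈-allSubsets (outside ∷ X) = ∈-++⁺ˡ (∈-map⁺ _ (∈-allSubsets X))
∈-allSubsets (inside ∷ X)  = ∈-++⁺ʳ _ (∈-map⁺ _ (∈-allSubsets X))

x∈p─q⇒x∉q : ∀ {n} {x} (p q : Subset n) → x ∈ p ─ q → x ∉ q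
x∈p─q⇒x∉q (_ ∷ p) (outside ∷ q) (there x∈p─q) (there x∈q) = x∈p─q⇒x∉q p q x∈p─q x∈q
x∈p─q⇒x∉q (_ ∷ p) (inside ∷ q)  (there x∈p─q) (there x∈q) = x∈p─q⇒x∉q p q x∈p─q x∈q

∣p∪q∣≤∣p∣+∣q∣ : ∀ {n} (p q : Subset n) → ∣ p ∪ q ∣ ≤ ∣ p ∣ + ∣ q ∣
∣p∪q∣≤∣p∣+∣q∣ []            []            = z≤n
∣p∪q∣≤∣p∣+∣q∣ (outside ∷ p) (outside ∷ q) = ∣p∪q∣≤∣p∣+∣q∣ p q
∣p∪q∣≤∣p∣+∣q∣ (outside ∷ p) (inside ∷ q)  =
  ≤-trans (s≤s (∣p∪q∣≤∣p∣+∣q∣ p q)) (≤-reflexive (sym (+-suc ∣ p ∣ ∣ q ∣)))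
∣p∪q∣≤∣p∣+∣q∣ (inside ∷ p)  (outside ∷ q) = s≤s (∣p∪q∣≤∣p∣+∣q∣ p q)
∣p∪q∣≤∣p∣+∣q∣ (inside ∷ p)  (inside ∷ q)  =
  s≤s (≤-trans (∣p∪q∣≤∣p∣+∣q∣ p q) (+-monoʳ-≤ ∣ p ∣ (m≤n⇒m≤1+n ≤-refl)))

module _ {n : ℕ} where

  p⊆q∧x∉p⇒p⊆q-x : ∀ {p q : Subset n} {x} → p ⊆ q → x ∉ p → p ⊆ q - x
  p⊆q∧x∉p⇒p⊆q-x p⊆q x∉p y∈p =
    x∈p∧x≢y⇒x∈p-y (p⊆q y∈p) (λ { refl → x∉p y∈p })

  ∣p∣≤1+∣p-x∣ : ∀ (p : Subset n) x → ∣ p ∣ ≤ suc ∣ p - x ∣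
  ∣p∣≤1+∣p-x∣ p x = begin
    ∣ p ∣                      ≤⟨ p⊆q⇒∣p∣≤∣q∣ p⊆⁅x⁆∪p-x ⟩
    ∣ ⁅ x ⁆ ∪ (p - x) ∣        ≤⟨ ∣p∪q∣≤∣p∣+∣q∣ ⁅ x ⁆ (p - x) ⟩
    ∣ ⁅ x ⁆ ∣ + ∣ p - x ∣      ≡⟨ cong (_+ ∣ p - x ∣) (∣⁅x⁆∣≡1 x) ⟩
    suc ∣ p - x ∣              ∎
    where
    open ≤-Reasoning
    p⊆⁅x⁆∪p-x : p ⊆ ⁅ x ⁆ ∪ (p - x)
    p⊆⁅x⁆∪p-x {y} y∈p with y ≟ x
    ... | yes refl = x∈p∪q⁺ (inj₁ (x∈⁅x⁆ x))
    ... | no y≢x   = x∈p∪q⁺ (inj₂ (x∈p∧x≢y⇒x∈p-y y∈p y≢x))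

  -- Deleting `x` and then `y` from `q` still leaves `p` inside, and each deletion lowers the
  -- cardinality.
  two-outside : ∀ {p q : Subset n} {x y} → p ⊆ q → x ≢ y →
                x ∈ q → x ∉ p → y ∈ q → y ∉ p → 2 + ∣ p ∣ ≤ ∣ q ∣
  two-outside p⊆q x≢y x∈q x∉p y∈q y∉p =
    ≤-trans
      (s≤s (≤-trans
        (s≤s (p⊆q⇒∣p∣≤∣q∣ (p⊆q∧x∉p⇒p⊆q-x (p⊆q∧x∉p⇒p⊆q-x p⊆q x∉p) y∉p)))
        (x∈p⇒∣p-x∣<∣p∣ (x∈p∧x≢y⇒x∈p-y y∈q (≢-sym x≢y)))))
      (x∈p⇒∣p-x∣<∣p∣ x∈q)

  three-outside : ∀ {p q : Subset n} {x y z} → p ⊆ q → x ≢ y → x ≢ z → y ≢ z →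
                  x ∈ q → x ∉ p → y ∈ q → y ∉ p → z ∈ q → z ∉ p → 3 + ∣ p ∣ ≤ ∣ q ∣
  three-outside p⊆q x≢y x≢z y≢z x∈q x∉p y∈q y∉p z∈q z∉p =
    ≤-trans
      (s≤s (two-outside (p⊆q∧x∉p⇒p⊆q-x p⊆q x∉p) y≢z
        (x∈p∧x≢y⇒x∈p-y y∈q (≢-sym x≢y)) y∉p
        (x∈p∧x≢y⇒x∈p-y z∈q (≢-sym x≢z)) z∉p))
      (x∈p⇒∣p-x∣<∣p∣ x∈q)

  p⊈q⇒∃∈p∉q : ∀ {p q : Subset n} → ¬ p ⊆ q → ∃[ x ] x ∈ p × x ∉ q
  p⊈q⇒∃∈p∉q {p} {q} p⊈q with nonempty? (p ─ q)
  ... | yes (x , x∈p─q) = x , p─q⊆p p q x∈p─q , x∈p─q⇒x∉q p q x∈p─q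
  ... | no p─q-empty    = ⊥-elim (p⊈q p⊆q)
    where
    p⊆q : p ⊆ q
    p⊆q {x} x∈p with x ∈? q
    ... | yes x∈q = x∈q
    ... | no x∉q  = contradiction (x , x∈p∧x∉q⇒x∈p─q x∈p x∉q) p─q-empty

  -- The shared `x` can be deleted from `q` without shrinking the union, which makes the subadditive
  -- bound strict.
  ∣p∪q∣<∣p∣+∣q∣ : ∀ {p q : Subset n} {x} → x ∈ p → x ∈ q → ∣ p ∪ q ∣ < ∣ p ∣ + ∣ q ∣
  ∣p∪q∣<∣p∣+∣q∣ {p} {q} {x} x∈p x∈q = begin-strict
    ∣ p ∪ q ∣          ≤⟨ p⊆q⇒∣p∣≤∣q∣ p∪q⊆p∪q-x ⟩
    ∣ p ∪ (q - x) ∣    ≤⟨ ∣p∪q∣≤∣p∣+∣q∣ p (q - x) ⟩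
    ∣ p ∣ + ∣ q - x ∣  <⟨ +-monoʳ-< ∣ p ∣ (x∈p⇒∣p-x∣<∣p∣ x∈q) ⟩
    ∣ p ∣ + ∣ q ∣      ∎
    where
    open ≤-Reasoning
    p∪q⊆p∪q-x : p ∪ q ⊆ p ∪ (q - x)
    p∪q⊆p∪q-x {y} y∈p∪q with y ≟ x | x∈p∪q⁻ p q y∈p∪q
    ... | yes refl | _        = x∈p∪q⁺ (inj₁ x∈p)
    ... | no _     | inj₁ y∈p = x∈p∪q⁺ (inj₁ y∈p)
    ... | no y≢x   | inj₂ y∈q = x∈p∪q⁺ (inj₂ (x∈p∧x≢y⇒x∈p-y y∈q y≢x))

  -- Membership in symmetric differences.

  ∈△⁺ˡ : ∀ {p q : Subset n} {x} → x ∈ p → x ∉ q → x ∈ p △ q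
  ∈△⁺ˡ x∈p x∉q = x∈p∪q⁺ (inj₁ (x∈p∧x∉q⇒x∈p─q x∈p x∉q))

  ∈△⁺ʳ : ∀ {p q : Subset n} {x} → x ∉ p → x ∈ q → x ∈ p △ q
  ∈△⁺ʳ x∉p x∈q = x∈p∪q⁺ (inj₂ (x∈p∧x∉q⇒x∈p─q x∈q x∉p))

  ∈△⁻ : ∀ (p q : Subset n) {x} → x ∈ p △ q → (x ∈ p × x ∉ q) ⊎ (x ∉ p × x ∈ q)
  ∈△⁻ p q x∈p△q with x∈p∪q⁻ (p ─ q) (q ─ p) x∈p△q
  ... | inj₁ x∈p─q = inj₁ (p─q⊆p p q x∈p─q , x∈p─q⇒x∉q p q x∈p─q)
  ... | inj₂ x∈q─p = inj₂ (x∈p─q⇒x∉q q p x∈q─p , p─q⊆p q p x∈q─p)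

  ∈∩⇒∉△ : ∀ (p q : Subset n) {x} → x ∈ p → x ∈ q → x ∉ p △ q
  ∈∩⇒∉△ p q x∈p x∈q x∈p△q with ∈△⁻ p q x∈p△q
  ... | inj₁ (_ , x∉q) = x∉q x∈q
  ... | inj₂ (x∉p , _) = x∉p x∈p

  ∉∪⇒∉△ : ∀ (p q : Subset n) {x} → x ∉ p → x ∉ q → x ∉ p △ q
  ∉∪⇒∉△ p q x∉p x∉q x∈p△q with ∈△⁻ p q x∈p△q
  ... | inj₁ (x∈p , _) = x∉p x∈p
  ... | inj₂ (_ , x∈q) = x∉q x∈q

  △-⊆ : ∀ {p q r : Subset n} → p ⊆ r → q ⊆ r → p △ q ⊆ r
  △-⊆ {p} {q} p⊆r q⊆r x∈p△q with ∈△⁻ p q x∈p△q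
  ... | inj₁ (x∈p , _) = p⊆r x∈p
  ... | inj₂ (_ , x∈q) = q⊆r x∈q

-- Rank, bases and circuits.

module _ {n : ℕ} (M : Matroid n) where
  open Matroid M

  Indep⇒∣I∣≤rank : ∀ {I X} → I ⊆ X → Indep I → ∣ I ∣ ≤ rank X
  Indep⇒∣I∣≤rank {I} {X} I⊆X indI =
    All.lookup (xs≤max 0 _)
      (∈-map⁺ ∣_∣ (∈-filter⁺ (λ J → (J ⊆? X) ×-dec indep? J) (∈-allSubsets I) (I⊆X , indI)))

  basis : ∀ X → ∃[ I ] I ⊆ X × Indep I × rank X ≤ ∣ I ∣
  basis X with argmax-sel id 0 _
  -- A maximum is either its default value or an entry of the list; in the default case the rank is
  -- 0 and the empty set suffices.
  ... | inj₁ rank≡0 =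
    _ , (λ x∈⊥ → contradiction x∈⊥ ∉⊥) , ⊥-indep , subst (_≤ _) (sym rank≡0) z≤n
  ... | inj₂ rank∈ with ∈-map⁻ ∣_∣ rank∈
  ... | I , I∈ , rank≡∣I∣ with ∈-filter⁻ (λ J → (J ⊆? X) ×-dec indep? J) {xs = allSubsets n} I∈
  ... | _ , I⊆X , indI = I , I⊆X , indI , ≤-reflexive rank≡∣I∣

  -- Heredity would otherwise make `C` independent. This picks from each circuit an element that a
  -- basis omits.
  dependent⊈independent : ∀ {C I} → ¬ Indep C → Indep I → ∃[ x ] x ∈ C × x ∉ I
  dependent⊈independent depC indI = p⊈q⇒∃∈p∉q (λ C⊆I → depC (hereditary C⊆I indI))

  circuit-nonempty : ∀ {C} → IsCircuit C → Nonempty C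
  circuit-nonempty (depC , _) with dependent⊈independent depC ⊥-indep
  ... | x , x∈C , _ = x , x∈C

  circuit⊄circuit : ∀ {C D x} → IsCircuit C → IsCircuit D → C ⊆ D → x ∈ D → x ∉ C → Absurd
  circuit⊄circuit (depC , _) (_ , minD) C⊆D x∈D x∉C = depC (minD (C⊆D , _ , x∈D , x∉C))

  -- By minimality, deleting one element of a circuit leaves an independent set.
  ∣circuit∣≤1+rank : ∀ {C} → IsCircuit C → ∣ C ∣ ≤ suc (rank C)
  ∣circuit∣≤1+rank {C} circC@(_ , minC) with circuit-nonempty circC
  ... | x , x∈C =
    ≤-trans (∣p∣≤1+∣p-x∣ C x)
      (s≤s (Indep⇒∣I∣≤rank (p─q⊆p C ⁅ x ⁆) (minC (x∈p⇒p-x⊂p x∈C))))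

  -- Each circuit exceeds its rank by at most one, and skewness adds the two ranks, so the total
  -- loss is at most two.
  skew-basis : ∀ {C₁ C₂} → IsCircuit C₁ → IsCircuit C₂ → Skew C₁ C₂ →
               ∃[ I ] I ⊆ C₁ ∪ C₂ × Indep I × ∣ C₁ ∣ + ∣ C₂ ∣ ≤ 2 + ∣ I ∣
  skew-basis {C₁} {C₂} circ₁ circ₂ skew with basis (C₁ ∪ C₂)
  ... | I , I⊆ , indI , rank≤∣I∣ = I , I⊆ , indI , (begin
    ∣ C₁ ∣ + ∣ C₂ ∣                  ≤⟨ +-mono-≤ (∣circuit∣≤1+rank circ₁) (∣circuit∣≤1+rank circ₂) ⟩
    suc (rank C₁) + suc (rank C₂)    ≡⟨ cong suc (+-suc (rank C₁) (rank C₂)) ⟩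
    2 + (rank C₁ + rank C₂)          ≡⟨ cong (2 +_) (sym skew) ⟩
    2 + rank (C₁ ∪ C₂)               ≤⟨ +-monoʳ-≤ 2 rank≤∣I∣ ⟩
    2 + ∣ I ∣                        ∎)
    where open ≤-Reasoning

  -- Skew circuits in a circuit-difference matroid.

  module _ (circuit-△ : IsCircuitDifference) {C₁ C₂} (circ₁ : IsCircuit C₁) (circ₂ : IsCircuit C₂)
           (skew : Skew C₁ C₂) where

    -- A common element `e` makes the union smaller than `∣ C₁ ∣ + ∣ C₂ ∣`, so `I` omits at most one
    -- element of it; yet `two` exhibits two omitted ones.
    skew-disjoint : C₁ ≢ C₂ → ∀ {e} → e ∈ C₁ → e ∉ C₂
    skew-disjoint C₁≢C₂ e∈C₁ e∈C₂ with skew-basis circ₁ circ₂ skew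
    ... | I , I⊆ , indI , size = at-most-one-outside two
      where
      at-most-one-outside : ¬ (∃[ x ] ∃[ y ] x ≢ y × (x ∈ C₁ ∪ C₂ × x ∉ I) × (y ∈ C₁ ∪ C₂ × y ∉ I))
      at-most-one-outside (x , y , x≢y , (x∈ , x∉I) , (y∈ , y∉I)) =
        <-irrefl refl
          (<-≤-trans (∣p∪q∣<∣p∣+∣q∣ e∈C₁ e∈C₂)
            (≤-trans size (two-outside I⊆ x≢y x∈ x∉I y∈ y∉I)))

      two : ∃[ x ] ∃[ y ] x ≢ y × (x ∈ C₁ ∪ C₂ × x ∉ I) × (y ∈ C₁ ∪ C₂ × y ∉ I)
      two with circuit-△ circ₁ circ₂ C₁≢C₂ (_ , x∈p∩q⁺ (e∈C₁ , e∈C₂))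
      ... | dep△ , _ with dependent⊈independent dep△ indI
      ... | x , x∈△ , x∉I with ∈△⁻ C₁ C₂ x∈△
      -- `x` lies in exactly one of the two circuits, so any omitted element of the other one
      -- differs from `x`.
      ... | inj₁ (x∈C₁ , x∉C₂) =
        case dependent⊈independent (proj₁ circ₂) indI of λ
          { (y , y∈C₂ , y∉I) → x , y , (λ { refl → x∉C₂ y∈C₂ })
            , (x∈p∪q⁺ (inj₁ x∈C₁) , x∉I) , (x∈p∪q⁺ (inj₂ y∈C₂) , y∉I) }
      ... | inj₂ (x∉C₁ , x∈C₂) =
        case dependent⊈independent (proj₁ circ₁) indI of λ
          { (y , y∈C₁ , y∉I) → x , y , (λ { refl → x∉C₁ y∈C₁ })
            , (x∈p∪q⁺ (inj₂ x∈C₂) , x∉I) , (x∈p∪q⁺ (inj₁ y∈C₁) , y∉I) }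

    module _ (disjoint : ∀ {e} → e ∈ C₁ → e ∉ C₂) where

      module _ {D} (circD : IsCircuit D) {e f} (e∈C₁ : e ∈ C₁) (e∈D : e ∈ D)
               (f∈C₂ : f ∈ C₂) (f∈D : f ∈ D) where

        D△C₁-circuit : IsCircuit (D △ C₁)
        D△C₁-circuit = circuit-△ circD circ₁
          (λ { refl → disjoint f∈D f∈C₂ }) (e , x∈p∩q⁺ (e∈D , e∈C₁))

        D△C₂-circuit : IsCircuit (D △ C₂)
        D△C₂-circuit = circuit-△ circD circ₂
          (λ { refl → disjoint e∈C₁ e∈D }) (f , x∈p∩q⁺ (f∈D , f∈C₂))

        f∉C₁ : f ∉ C₁
        f∉C₁ f∈C₁ = disjoint f∈C₁ f∈C₂

        -- Under equality, an element of `C₁` missing from `D` would lie in `C₂`, against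
        -- disjointness; so `C₁` would sit inside `D`, properly because of `f`.
        D△C₁≢C₂ : D △ C₁ ≢ C₂
        D△C₁≢C₂ D△C₁≡C₂ = circuit⊄circuit circ₁ circD C₁⊆D f∈D f∉C₁
          where
          C₁⊆D : C₁ ⊆ D
          C₁⊆D {x} x∈C₁ with x ∈? D
          ... | yes x∈D = x∈D
          ... | no x∉D  = ⊥-elim (disjoint x∈C₁ (subst (x ∈_) D△C₁≡C₂ (∈△⁺ʳ x∉D x∈C₁)))

        D△C₁△C₂-circuit : IsCircuit (D △ C₁ △ C₂)
        D△C₁△C₂-circuit = circuit-△ D△C₁-circuit circ₂ D△C₁≢C₂
          (f , x∈p∩q⁺ (∈△⁺ˡ f∈D f∉C₁ , f∈C₂))

        D⊈C₁∪C₂ : ¬ D ⊆ C₁ ∪ C₂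
        D⊈C₁∪C₂ D⊆ with skew-basis circ₁ circ₂ skew
        ... | I , I⊆ , indI , size
          with dependent⊈independent (proj₁ circ₁) indI
             | dependent⊈independent (proj₁ circ₂) indI
        ... | x , x∈C₁ , x∉I | y , y∈C₂ , y∉I = absurd
          where
          C₁⊆ : C₁ ⊆ C₁ ∪ C₂
          C₁⊆ = p⊆p∪q C₂

          C₂⊆ : C₂ ⊆ C₁ ∪ C₂
          C₂⊆ = q⊆p∪q C₁ C₂

          x∉C₂ : x ∉ C₂
          x∉C₂ = disjoint x∈C₁

          y∉C₁ : y ∉ C₁
          y∉C₁ y∈C₁ = disjoint y∈C₁ y∈C₂

          in-I : ∀ {z} → z ∈ C₁ ∪ C₂ → z ≢ x → z ≢ y → z ∈ I
          in-I {z} z∈ z≢x z≢y with z ∈? I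
          ... | yes z∈I = z∈I
          -- A third omitted element would give `3 + ∣ I ∣ ≤ ∣ C₁ ∪ C₂ ∣ ≤ 2 + ∣ I ∣`.
          ... | no z∉I  = ⊥-elim (<-irrefl refl
            (≤-trans
              (three-outside I⊆ (λ { refl → x∉C₂ y∈C₂ }) (≢-sym z≢x) (≢-sym z≢y)
                (C₁⊆ x∈C₁) x∉I (C₂⊆ y∈C₂) y∉I z∈ z∉I)
              (≤-trans (∣p∪q∣≤∣p∣+∣q∣ C₁ C₂) size)))

          contains-x-or-y : ∀ {E} → IsCircuit E → E ⊆ C₁ ∪ C₂ → x ∉ E → y ∉ E → Absurd
          contains-x-or-y (depE , _) E⊆ x∉E y∉E =
            depE (hereditary
              (λ z∈E → in-I (E⊆ z∈E) (λ { refl → x∉E z∈E }) (λ { refl → y∉E z∈E })) indI)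

          absurd : Absurd
          -- The symmetric difference with `C₁` toggles `x` and fixes `y`; with `C₂` it is the
          -- reverse. Each case removes exactly those of `x` and `y` that `D` contains.
          absurd with x ∈? D | y ∈? D
          ... | no x∉D  | no y∉D  = contains-x-or-y circD D⊆ x∉D y∉D
          ... | yes x∈D | no y∉D  = contains-x-or-y D△C₁-circuit (△-⊆ D⊆ C₁⊆)
            (∈∩⇒∉△ D C₁ x∈D x∈C₁) (∉∪⇒∉△ D C₁ y∉D y∉C₁)
          ... | no x∉D  | yes y∈D = contains-x-or-y D△C₂-circuit (△-⊆ D⊆ C₂⊆)
            (∉∪⇒∉△ D C₂ x∉D x∉C₂) (∈∩⇒∉△ D C₂ y∈D y∈C₂)
          ... | yes x∈D | yes y∈D = contains-x-or-y D△C₁△C₂-circuit (△-⊆ (△-⊆ D⊆ C₁⊆) C₂⊆)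
            (∉∪⇒∉△ (D △ C₁) C₂ (∈∩⇒∉△ D C₁ x∈D x∈C₁) x∉C₂)
            (∈∩⇒∉△ (D △ C₁) C₂ (∈△⁺ˡ y∈D y∉C₁) y∈C₂)

        no-circuit-meets-both : Absurd
        no-circuit-meets-both with p⊈q⇒∃∈p∉q D⊈C₁∪C₂
        ... | z , z∈D , z∉ = circuit⊄circuit circ₁ D△D'-circuit C₁⊆ f∈D△D' f∉C₁
          where
          D' : Subset n
          D' = D △ C₁ △ C₂

          -- `z` lies outside `C₁` and `C₂`, so it survives both symmetric differences and is common
          -- to `D` and `D'`.
          z∈D' : z ∈ D'
          z∈D' = ∈△⁺ˡ (∈△⁺ˡ z∈D (λ z∈C₁ → z∉ (x∈p∪q⁺ (inj₁ z∈C₁)))) (λ z∈C₂ → z∉ (x∈p∪q⁺ (inj₂ z∈C₂)))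

          f∉D' : f ∉ D'
          f∉D' = ∈∩⇒∉△ (D △ C₁) C₂ (∈△⁺ˡ f∈D f∉C₁) f∈C₂

          f∈D△D' : f ∈ D △ D'
          f∈D△D' = ∈△⁺ˡ f∈D f∉D'

          D△D'-circuit : IsCircuit (D △ D')
          D△D'-circuit = circuit-△ circD D△C₁△C₂-circuit
            (λ D≡D' → f∉D' (subst (f ∈_) D≡D' f∈D)) (z , x∈p∩q⁺ (z∈D , z∈D'))

          -- By disjointness, passing from `D` to `D'` flips the membership of each element of `C₁`
          -- exactly once.
          C₁⊆ : C₁ ⊆ D △ D'
          C₁⊆ {w} w∈C₁ with w ∈? D
          ... | yes w∈D = ∈△⁺ˡ w∈D (∉∪⇒∉△ (D △ C₁) C₂ (∈∩⇒∉△ D C₁ w∈D w∈C₁) (disjoint w∈C₁))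
          ... | no w∉D  = ∈△⁺ʳ w∉D (∈△⁺ˡ (∈△⁺ʳ w∉D w∈C₁) (disjoint w∈C₁))

lemma1p2 : (n : ℕ) (M : Matroid n) → Matroid.IsConnected M → IsBinary M →
    Matroid.HasSkewCircuits M → ¬ Matroid.IsCircuitDifference M
lemma1p2 n M connected _ (C₁ , C₂ , circ₁ , circ₂ , C₁≢C₂ , skew) circuit-△ =
  let disjoint              = λ {x} → skew-disjoint M circuit-△ circ₁ circ₂ skew C₁≢C₂ {x}
      e , e∈C₁              = circuit-nonempty M circ₁
      f , f∈C₂              = circuit-nonempty M circ₂
      -- Connectedness applies to distinct elements only; disjointness separates `e` from `f`.
      D , circD , e∈D , f∈D = connected
                                (λ e≡f → disjoint e∈C₁ (subst (_∈ C₂) (sym e≡f) f∈C₂))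
  in no-circuit-meets-both M circuit-△ circ₁ circ₂ skew disjoint circD e∈C₁ e∈D f∈C₂ f∈D
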